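{- Let $\Sigma$ be a finite alphabet. Any multi-scale coverable $\mathbb{Z}^2$-word $\mathbf{w}:\mathbb{Z}^2\to\Sigma$ has zero topological entropy.
   Context: A block of size $k\times\ell$ is a finite word indexed by a rectangle of width $k$ and height $\ell$. A block $q$ is a cover of $\mathbf{w}$ if every position of $\mathbb{Z}^2$ belongs to some occurrence of $q$ in $\mathbf{w}$. $\mathbf{w}$ is multi-scale coverable if for each $n\in\mathbb{N}$ it has a cover of size $k\times\ell$ with both $k\ge n$ and $\ell\ge n$. With $c_{\mathbf{w}}(n,m)$ the number of different blocks of size $n\times m$ occurring in $\mathbf{w}$, the topological entropy is $H(\mathbf{w})=\lim_{n\to+\infty}\frac{\log_{|\Sigma|}c_{\mathbf{w}}(n,n)}{n^2}$ (with $|\Sigma|\ge2$). -}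

module Defs where

open import Data.Empty using (⊥; ⊥-elim)
open import Data.Fin using (Fin; toℕ)
open import Data.Integer as ℤ using (ℤ; +_; -[1+_]; +<+; -<+)
import Data.Integer.Properties as ℤ
open import Data.List as List using (List; []; _∷_; length; cartesianProductWith; allFin)
open import Data.List.Membership.Propositional using (_∈_)
open import Data.List.Membership.Propositional.Properties
  using (∈-cartesianProductWith⁺; ∈-map⁺; ∈-allFin)
open import Data.List.Membership.Propositional.Properties.WithK using (unique∧set⇒bag)
open import Data.List.Relation.Binary.BagAndSetEquality using (∼bag⇒↭)
open import Data.List.Relation.Binary.Permutation.Propositional.Properties using (↭-length)
open import Data.List.Relation.Unary.All as All using ([]; _∷_)
open import Data.List.Relation.Unary.AllPairs using ([]; _∷_)
open import Data.List.Relation.Unary.Any using (here; there)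
open import Data.List.Relation.Unary.Unique.Propositional using (Unique)
open import Data.List.Relation.Unary.Unique.Propositional.Properties as Unique
  using (Unique[x∷xs]⇒x∉xs)
open import Data.Nat as ℕ
  using (ℕ; zero; suc; _+_; _*_; _^_; _≤_; _<_; z≤n; s≤s; NonZero; NonTrivial)
import Data.Nat.Properties as ℕ
open import Data.Product using (∃; ∃-syntax; _×_; _,_; proj₁; proj₂)
open import Data.Rational.Unnormalised as ℚ using (ℚᵘ; mkℚᵘ; 0ℚᵘ; 1ℚᵘ; *<*; *≡*)
import Data.Rational.Unnormalised.Properties as ℚ
open import Data.Sum using (_⊎_; inj₁; inj₂)
open import Data.Unit using (⊤; tt)
open import Data.Vec using (Vec; []; _∷_; lookup; tabulate)
open import Data.Vec.Properties using (lookup∘tabulate; ∷-injective)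
open import Function.Base using (_∘_)
open import Function.Bundles using (_⇔_; _↔_; mk⇔; Equivalence; Inverse)
open import Level using (Level)
open import Relation.Binary.PropositionalEquality
open import Relation.Nullary using (¬_; yes; no; contradiction)

private variable
  a : Level
  A : Set a

-- Two-sided, located Dedekind cuts.

record ℝ : Set₁ where
  field
    lower           : ℚᵘ → Set
    upper           : ℚᵘ → Set
    lower-inhabited : ∃ lower
    upper-inhabited : ∃ upper
    lower-closed    : ∀ {q r} → q ℚ.< r → lower r → lower q
    upper-closed    : ∀ {q r} → q ℚ.< r → upper q → upper r
    lower-open      : ∀ {q} → lower q → ∃[ r ] q ℚ.< r × lower r
    upper-open      : ∀ {r} → upper r → ∃[ q ] q ℚ.< r × upper q
    disjoint        : ∀ {q} → lower q → ¬ upper q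
    located         : ∀ {q r} → q ℚ.< r → lower q ⊎ upper r

open ℝ public

lower-resp-≃ : ∀ (x : ℝ) {q r} → q ℚ.≃ r → lower x q → lower x r
lower-resp-≃ x q≃r l with lower-open x l
... | _ , q<t , lt = lower-closed x (ℚ.<-respˡ-≃ q≃r q<t) lt

upper-resp-≃ : ∀ (x : ℝ) {q r} → q ℚ.≃ r → upper x q → upper x r
upper-resp-≃ x q≃r u with upper-open x u
... | _ , t<q , ut = upper-closed x (ℚ.<-respʳ-≃ q≃r t<q) ut

infix 4 _<ᵣ_

_<ᵣ_ : ℝ → ℝ → Set
x <ᵣ y = ∃[ q ] upper x q × lower y q

private
  -- The preimage of a cut under an order automorphism of ℚᵘ.
  reparam : (f g : ℚᵘ → ℚᵘ) →
            (∀ {q r} → q ℚ.< r → f q ℚ.< f r) →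
            (∀ {q r} → q ℚ.< r → g q ℚ.< g r) →
            (∀ q → f (g q) ℚ.≃ q) → (∀ q → g (f q) ℚ.≃ q) →
            ℝ → ℝ
  reparam f g f-mono g-mono fg gf x = record
    { lower           = λ q → lower x (f q)
    ; upper           = λ q → upper x (f q)
    ; lower-inhabited = let q , l = lower-inhabited x in
                        g q , lower-resp-≃ x (ℚ.≃-sym (fg q)) l
    ; upper-inhabited = let q , u = upper-inhabited x in
                        g q , upper-resp-≃ x (ℚ.≃-sym (fg q)) u
    ; lower-closed    = λ q<r → lower-closed x (f-mono q<r)
    ; upper-closed    = λ q<r → upper-closed x (f-mono q<r)
    ; lower-open      = λ {q} l → let t , q<t , lt = lower-open x l in
                        g t , ℚ.<-respˡ-≃ (gf q) (g-mono q<t) ,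
                        lower-resp-≃ x (ℚ.≃-sym (fg t)) lt
    ; upper-open      = λ {r} u → let t , t<r , ut = upper-open x u in
                        g t , ℚ.<-respʳ-≃ (gf r) (g-mono t<r) ,
                        upper-resp-≃ x (ℚ.≃-sym (fg t)) ut
    ; disjoint        = disjoint x
    ; located         = λ q<r → located x (f-mono q<r)
    }

  cancel : ∀ q s t → s ℚ.+ t ℚ.≃ 0ℚᵘ → (q ℚ.+ s) ℚ.+ t ℚ.≃ q
  cancel q s t eq = ℚ.≃-trans (ℚ.+-assoc q s t)
    (ℚ.≃-trans (ℚ.+-congʳ q eq) (ℚ.+-identityʳ q))

  cancel* : ∀ q s t → s ℚ.* t ℚ.≃ 1ℚᵘ → (q ℚ.* s) ℚ.* t ℚ.≃ q
  cancel* q s t eq = ℚ.≃-trans (ℚ.*-assoc q s t)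
    (ℚ.≃-trans (ℚ.*-congˡ {q} eq) (ℚ.*-identityʳ q))

fromℚ : ℚᵘ → ℝ
fromℚ s = record
  { lower           = ℚ._< s
  ; upper           = s ℚ.<_
  ; lower-inhabited = s ℚ.- 1ℚᵘ , ℚ.<-respʳ-≃ (ℚ.+-identityʳ s)
                        (ℚ.+-monoʳ-< s {ℚ.- 1ℚᵘ} {0ℚᵘ} (*<* -<+))
  ; upper-inhabited = s ℚ.+ 1ℚᵘ , ℚ.<-respˡ-≃ (ℚ.+-identityʳ s)
                        (ℚ.+-monoʳ-< s {0ℚᵘ} {1ℚᵘ} (*<* (+<+ (s≤s z≤n))))
  ; lower-closed    = ℚ.<-trans
  ; upper-closed    = λ q<r s<q → ℚ.<-trans s<q q<r
  ; lower-open      = ℚ.<-dense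
  ; upper-open      = λ s<r → let t , s<t , t<r = ℚ.<-dense s<r in t , t<r , s<t
  ; disjoint        = ℚ.<-asym
  ; located         = λ {q} q<r → located′ q<r
  }
  where
  located′ : ∀ {q r} → q ℚ.< r → q ℚ.< s ⊎ s ℚ.< r
  located′ {q} q<r with q ℚ.<? s
  ... | yes q<s = inj₁ q<s
  ... | no  q≮s = inj₂ (ℚ.≤-<-trans (ℚ.≮⇒≥ q≮s) q<r)

0ℝ : ℝ
0ℝ = fromℚ 0ℚᵘ

infixl 6 _+ℚ_ _-ℚ_

_+ℚ_ : ℝ → ℚᵘ → ℝ
x +ℚ s = reparam (ℚ._- s) (ℚ._+ s)
  (ℚ.+-monoˡ-< (ℚ.- s)) (ℚ.+-monoˡ-< s)
  (λ q → cancel q s (ℚ.- s) (ℚ.+-inverseʳ s))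
  (λ q → cancel q (ℚ.- s) s (ℚ.+-inverseˡ s)) x

_-ℚ_ : ℝ → ℚᵘ → ℝ
x -ℚ s = x +ℚ (ℚ.- s)

infixl 7 _÷ℕ_

_÷ℕ_ : ℝ → (m : ℕ) → .{{NonZero m}} → ℝ
x ÷ℕ m@(suc k) = reparam (ℚ._* M) (ℚ._* (ℚ.1/ M))
  (ℚ.*-monoˡ-<-pos M) (ℚ.*-monoˡ-<-pos (ℚ.1/ M))
  (λ q → cancel* q (ℚ.1/ M) M (ℚ.*-inverseˡ M))
  (λ q → cancel* q M (ℚ.1/ M) (ℚ.*-inverseʳ M)) x
  where
  M : ℚᵘ
  M = mkℚᵘ (+ m) 0

-- ∣ x − y ∣ < ε, as y − ε < x < y + ε
CloserThan : ℚᵘ → ℝ → ℝ → Set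
CloserThan ε x y = (y -ℚ ε <ᵣ x) × (x <ᵣ y +ℚ ε)

-- The logarithm of a positive integer c to an integer base b ≥ 2.
-- For d ≥ 1 and p ≥ 0, p / d < log_b c iff b ^ p < c ^ d (and likewise
-- for >); negative rationals lie below log_b c since c ≥ 1.

module _ (b c : ℕ) where

  LogLower LogUpper : ℚᵘ → Set
  LogLower (mkℚᵘ (+ p)    d-1) = b ^ p < c ^ suc d-1
  LogLower (mkℚᵘ -[1+ _ ] d-1) = ⊤
  LogUpper (mkℚᵘ (+ p)    d-1) = c ^ suc d-1 < b ^ p
  LogUpper (mkℚᵘ -[1+ _ ] d-1) = ⊥

private
  ^-swap : ∀ m n o → (m ^ n) ^ o ≡ (m ^ o) ^ n
  ^-swap m n o = trans (ℕ.^-*-assoc m n o)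
    (trans (cong (m ^_) (ℕ.*-comm n o)) (sym (ℕ.^-*-assoc m o n)))

  bernoulli : ∀ x k → x ^ suc k + suc k * x ^ k ≤ suc x ^ suc k
  bernoulli x zero    = ℕ.≤-reflexive (ℕ.+-comm (x * 1) 1)
  bernoulli x (suc k) = begin
    x * X + (X + suc k * X)               ≡⟨ cong (λ z → x * X + (X + z)) eq ⟩
    x * X + (X + x * (suc k * x ^ k))     ≡⟨ cong (x * X ℕ.+_) (ℕ.+-comm X _) ⟩
    x * X + (x * (suc k * x ^ k) + X)     ≡⟨ ℕ.+-assoc (x * X) _ X ⟨
    x * X + x * (suc k * x ^ k) + X       ≡⟨ cong (_+ X) (ℕ.*-distribˡ-+ x X _) ⟨
    x * (X + suc k * x ^ k) + X           ≤⟨ ℕ.+-mono-≤ (ℕ.*-monoʳ-≤ x (bernoulli x k))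
                                               (ℕ.^-monoˡ-≤ (suc k) (ℕ.n≤1+n x)) ⟩
    x * suc x ^ suc k + suc x ^ suc k     ≡⟨ ℕ.+-comm (x * suc x ^ suc k) _ ⟩
    suc x * suc x ^ suc k                 ∎
    where
    open ℕ.≤-Reasoning
    X = x ^ suc k
    eq : suc k * X ≡ x * (suc k * x ^ k)
    eq = trans (sym (ℕ.*-assoc (suc k) x (x ^ k)))
         (trans (cong (_* x ^ k) (ℕ.*-comm (suc k) x)) (ℕ.*-assoc x (suc k) (x ^ k)))

  power-gap : ∀ b {x y} .{{_ : NonZero b}} .{{_ : NonZero x}} → x < y →
              ∃[ k ] b * x ^ suc k < y ^ suc k
  power-gap b@(suc b-1) {x@(suc x-1)} {y} x<y = k , (begin-strict
    b * (x * x ^ k)                 ≡⟨ ℕ.*-assoc b x (x ^ k) ⟨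
    suc k * x ^ k                   <⟨ ℕ.m<n+m _ {x ^ suc k} (ℕ.m^n>0 x (suc k)) ⟩
    x ^ suc k + suc k * x ^ k       ≤⟨ bernoulli x k ⟩
    suc x ^ suc k                   ≤⟨ ℕ.^-monoˡ-≤ (suc k) x<y ⟩
    y ^ suc k                       ∎)
    where
    open ℕ.≤-Reasoning
    k = x-1 + b-1 * x

  n<b^n : ∀ b .{{_ : NonTrivial b}} n → n < b ^ n
  n<b^n b zero    = s≤s z≤n
  n<b^n b (suc n) = ℕ.≤-<-trans (n<b^n b n)
    (ℕ.^-monoʳ-< b (ℕ.nonTrivial⇒n>1 b) (ℕ.n<1+n n))

  drop-<ℕ : ∀ {p d p′ d′} → mkℚᵘ (+ p) d ℚ.< mkℚᵘ (+ p′) d′ → p * suc d′ < p′ * suc d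
  drop-<ℕ {p} {d} {p′} {d′} (*<* lt) = ℤ.drop‿+<+
    (subst₂ ℤ._<_ (sym (ℤ.pos-* p (suc d′))) (sym (ℤ.pos-* p′ (suc d))) lt)

  mk-<ℕ : ∀ {p d p′ d′} → p * suc d′ < p′ * suc d → mkℚᵘ (+ p) d ℚ.< mkℚᵘ (+ p′) d′
  mk-<ℕ {p} {d} {p′} {d′} lt = *<*
    (subst₂ ℤ._<_ (ℤ.pos-* p (suc d′)) (ℤ.pos-* p′ (suc d)) (+<+ lt))

  nonneg≮neg : ∀ {p d p′ d′} → ¬ (mkℚᵘ (+ p) d ℚ.< mkℚᵘ -[1+ p′ ] d′)
  nonneg≮neg {zero}  (*<* ())
  nonneg≮neg {suc p} (*<* ())

  module LogCut (b c : ℕ) .{{_ : NonTrivial b}} .{{_ : NonZero c}} where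
    open ℕ.≤-Reasoning

    instance
      b≢0 : NonZero b
      b≢0 = ℕ.nonTrivial⇒nonZero b

    module _ {p d p′ d′ : ℕ} where

      lower-mono : p * suc d′ ≤ p′ * suc d → b ^ p′ < c ^ suc d′ → b ^ p < c ^ suc d
      lower-mono le lt = ℕ.≰⇒> λ h → ℕ.<-irrefl refl (begin-strict
        (c ^ suc d′) ^ suc d   ≡⟨ ^-swap c (suc d′) (suc d) ⟩
        (c ^ suc d) ^ suc d′   ≤⟨ ℕ.^-monoˡ-≤ (suc d′) h ⟩
        (b ^ p) ^ suc d′       ≡⟨ ℕ.^-*-assoc b p (suc d′) ⟩
        b ^ (p * suc d′)       ≤⟨ ℕ.^-monoʳ-≤ b le ⟩
        b ^ (p′ * suc d)       ≡⟨ ℕ.^-*-assoc b p′ (suc d) ⟨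
        (b ^ p′) ^ suc d       <⟨ ℕ.^-monoˡ-< (suc d) lt ⟩
        (c ^ suc d′) ^ suc d   ∎)

      upper-mono : p * suc d′ ≤ p′ * suc d → c ^ suc d < b ^ p → c ^ suc d′ < b ^ p′
      upper-mono le lt = ℕ.≰⇒> λ h → ℕ.<-irrefl refl (begin-strict
        (b ^ p) ^ suc d′       ≡⟨ ℕ.^-*-assoc b p (suc d′) ⟩
        b ^ (p * suc d′)       ≤⟨ ℕ.^-monoʳ-≤ b le ⟩
        b ^ (p′ * suc d)       ≡⟨ ℕ.^-*-assoc b p′ (suc d) ⟨
        (b ^ p′) ^ suc d       ≤⟨ ℕ.^-monoˡ-≤ (suc d) h ⟩
        (c ^ suc d′) ^ suc d   ≡⟨ ^-swap c (suc d′) (suc d) ⟩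
        (c ^ suc d) ^ suc d′   <⟨ ℕ.^-monoˡ-< (suc d′) lt ⟩
        (b ^ p) ^ suc d′       ∎)

      upper-strict : p * suc d′ < p′ * suc d → c ^ suc d ≤ b ^ p → c ^ suc d′ < b ^ p′
      upper-strict lt le = ℕ.≰⇒> λ h → ℕ.<-irrefl refl (begin-strict
        (b ^ p′) ^ suc d       ≤⟨ ℕ.^-monoˡ-≤ (suc d) h ⟩
        (c ^ suc d′) ^ suc d   ≡⟨ ^-swap c (suc d′) (suc d) ⟩
        (c ^ suc d) ^ suc d′   ≤⟨ ℕ.^-monoˡ-≤ (suc d′) le ⟩
        (b ^ p) ^ suc d′       ≡⟨ ℕ.^-*-assoc b p (suc d′) ⟩
        b ^ (p * suc d′)       <⟨ ℕ.^-monoʳ-< b (ℕ.nonTrivial⇒n>1 b) lt ⟩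
        b ^ (p′ * suc d)       ≡⟨ ℕ.^-*-assoc b p′ (suc d) ⟨
        (b ^ p′) ^ suc d       ∎)

    closedˡ : ∀ {q r} → q ℚ.< r → LogLower b c r → LogLower b c q
    closedˡ {mkℚᵘ -[1+ _ ] _} {_}               q<r l = tt
    closedˡ {mkℚᵘ (+ p) d}    {mkℚᵘ (+ p′) d′}  q<r l =
      lower-mono {p} {d} {p′} {d′} (ℕ.<⇒≤ (drop-<ℕ q<r)) l
    closedˡ {mkℚᵘ (+ p) d}    {mkℚᵘ -[1+ _ ] _} q<r l = ⊥-elim (nonneg≮neg q<r)

    closedᵘ : ∀ {q r} → q ℚ.< r → LogUpper b c q → LogUpper b c r
    closedᵘ {mkℚᵘ (+ p) d} {mkℚᵘ (+ p′) d′}  q<r u =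
      upper-mono {p} {d} {p′} {d′} (ℕ.<⇒≤ (drop-<ℕ q<r)) u
    closedᵘ {mkℚᵘ (+ p) d} {mkℚᵘ -[1+ _ ] _} q<r u = ⊥-elim (nonneg≮neg q<r)

    openˡ : ∀ {q} → LogLower b c q → ∃[ r ] q ℚ.< r × LogLower b c r
    openˡ {q@(mkℚᵘ -[1+ n ] d)} l = r , q<r , tt
      where
      r : ℚᵘ
      r = mkℚᵘ -[1+ n ] (suc d)
      q<r : q ℚ.< r
      q<r = *<* (ℤ.*-monoˡ-<-neg -[1+ n ] (+<+ (ℕ.n<1+n (suc d))))
    openˡ {mkℚᵘ (+ p) d} l = mkℚᵘ (+ suc (p * suc k)) (k + d * suc k) , mk-<ℕ q<r , (begin-strict
        b * b ^ (p * suc k)        ≡⟨ cong (b *_) (ℕ.^-*-assoc b p (suc k)) ⟨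
        b * (b ^ p) ^ suc k        <⟨ proj₂ gap ⟩
        (c ^ suc d) ^ suc k        ≡⟨ ℕ.^-*-assoc c (suc d) (suc k) ⟩
        c ^ (suc d * suc k)        ∎)
      where
      gap = power-gap b {b ^ p} {{b≢0}} {{ℕ.m^n≢0 b p}} l
      k = proj₁ gap
      q<r : p * (suc d * suc k) < suc (p * suc k) * suc d
      q<r = begin-strict
        p * (suc d * suc k)        ≡⟨ cong (p *_) (ℕ.*-comm (suc d) (suc k)) ⟩
        p * (suc k * suc d)        ≡⟨ ℕ.*-assoc p (suc k) (suc d) ⟨
        p * suc k * suc d          <⟨ ℕ.*-monoˡ-< (suc d) (ℕ.n<1+n (p * suc k)) ⟩
        suc (p * suc k) * suc d    ∎

    openᵘ : ∀ {r} → LogUpper b c r → ∃[ q ] q ℚ.< r × LogUpper b c q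
    openᵘ {mkℚᵘ (+ zero)  d} u = contradiction u (ℕ.≤⇒≯ (ℕ.m^n>0 c (suc d)))
    openᵘ {mkℚᵘ (+ suc p) d} u = mkℚᵘ (+ (k + p * suc k)) (k + d * suc k) , mk-<ℕ q<r ,
        ℕ.*-cancelˡ-< b _ _ (begin-strict
        b * c ^ (suc d * suc k)    ≡⟨ cong (b *_) (ℕ.^-*-assoc c (suc d) (suc k)) ⟨
        b * (c ^ suc d) ^ suc k    <⟨ proj₂ gap ⟩
        (b ^ suc p) ^ suc k        ≡⟨ ℕ.^-*-assoc b (suc p) (suc k) ⟩
        b ^ (suc p * suc k)        ∎)
      where
      gap = power-gap b {c ^ suc d} {{b≢0}} {{ℕ.m^n≢0 c (suc d)}} u
      k = proj₁ gap
      q<r : (k + p * suc k) * suc d < suc p * (suc d * suc k)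
      q<r = begin-strict
        (k + p * suc k) * suc d    <⟨ ℕ.*-monoˡ-< (suc d) (ℕ.n<1+n (k + p * suc k)) ⟩
        suc p * suc k * suc d      ≡⟨ ℕ.*-assoc (suc p) (suc k) (suc d) ⟩
        suc p * (suc k * suc d)    ≡⟨ cong (suc p *_) (ℕ.*-comm (suc k) (suc d)) ⟩
        suc p * (suc d * suc k)    ∎

    disjointˡᵘ : ∀ {q} → LogLower b c q → ¬ LogUpper b c q
    disjointˡᵘ {mkℚᵘ (+ p) d} l u = ℕ.<-asym l u

    locatedˡᵘ : ∀ {q r} → q ℚ.< r → LogLower b c q ⊎ LogUpper b c r
    locatedˡᵘ {mkℚᵘ -[1+ _ ] _} {_}               q<r = inj₁ tt
    locatedˡᵘ {mkℚᵘ (+ p) d}    {mkℚᵘ -[1+ _ ] _} q<r = ⊥-elim (nonneg≮neg q<r)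
    locatedˡᵘ {mkℚᵘ (+ p) d}    {mkℚᵘ (+ p′) d′}  q<r with b ^ p ℕ.<? c ^ suc d
    ... | yes lt = inj₁ lt
    ... | no ¬lt = inj₂ (upper-strict {p} {d} {p′} {d′} (drop-<ℕ q<r) (ℕ.≮⇒≥ ¬lt))

    inhabitedᵘ : ∃ (LogUpper b c)
    inhabitedᵘ = mkℚᵘ (+ c) 0 ,
      subst (_< b ^ c) (sym (ℕ.*-identityʳ c)) (n<b^n b c)

log : (b c : ℕ) .{{_ : NonTrivial b}} .{{c≢0 : NonZero c}} → ℝ
log b c = record
  { lower           = LogLower b c
  ; upper           = LogUpper b c
  ; lower-inhabited = ℚ.- 1ℚᵘ , tt
  ; upper-inhabited = inhabitedᵘ
  ; lower-closed    = closedˡ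
  ; upper-closed    = closedᵘ
  ; lower-open      = openˡ
  ; upper-open      = openᵘ
  ; disjoint        = λ {q} → disjointˡᵘ {q}
  ; located         = locatedˡᵘ
  }
  where open LogCut b c

ℤ²-Word : Set a → Set a
ℤ²-Word A = ℤ × ℤ → A

-- Width k, height ℓ: a vector of ℓ rows of length k.
Block : Set a → ℕ → ℕ → Set a
Block A k ℓ = Vec (Vec A k) ℓ

module _ {A : Set a} (w : ℤ²-Word A) where

  OccursAt : ∀ {k ℓ} → Block A k ℓ → ℤ × ℤ → Set a
  OccursAt {k} {ℓ} q (x , y) = (i : Fin k) (j : Fin ℓ) →
    w (x ℤ.+ + toℕ i , y ℤ.+ + toℕ j) ≡ lookup (lookup q j) i

  Occurs : ∀ {k ℓ} → Block A k ℓ → Set a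
  Occurs q = ∃[ v ] OccursAt q v

  -- z belongs to the k × ℓ rectangle whose corner of least coordinates is v.
  InRectangle : ℕ → ℕ → ℤ × ℤ → ℤ × ℤ → Set
  InRectangle k ℓ (x , y) z = ∃[ i ] ∃[ j ]
    z ≡ (x ℤ.+ + toℕ {k} i , y ℤ.+ + toℕ {ℓ} j)

  IsCover : ∀ {k ℓ} → Block A k ℓ → Set a
  IsCover {k} {ℓ} q = ∀ z → ∃[ v ] OccursAt q v × InRectangle k ℓ v z

  MultiScaleCoverable : Set a
  MultiScaleCoverable = ∀ n → ∃[ k ] ∃[ ℓ ] n ≤ k × n ≤ ℓ ×
    (∃[ q ] IsCover {k} {ℓ} q)

  -- c_w(n,m) = c.  A relation rather than a function, as it is not
  -- decidable which blocks occur in w; see Complexity-unique and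
  -- Complexity-exists.
  Complexity : ℕ → ℕ → ℕ → Set a
  Complexity n m c = ∃[ bs ] Unique bs ×
    (∀ (q : Block A n m) → q ∈ bs ⇔ Occurs q) × length bs ≡ c

  blockAt : ∀ k ℓ → ℤ × ℤ → Block A k ℓ
  blockAt k ℓ (x , y) = tabulate λ j → tabulate λ i →
    w (x ℤ.+ + toℕ i , y ℤ.+ + toℕ j)

  blockAt-occurs : ∀ k ℓ v → OccursAt (blockAt k ℓ v) v
  blockAt-occurs k ℓ v i j = sym (trans
    (cong (λ row → lookup row i) (lookup∘tabulate _ j)) (lookup∘tabulate _ i))

  Complexity-nonZero : ∀ {n m c} → Complexity n m c → NonZero c
  Complexity-nonZero {n} {m} ([] , _ , occ , refl)
    with () ← Equivalence.from (occ (blockAt n m (+ 0 , + 0))) ((+ 0 , + 0) , blockAt-occurs n m (+ 0 , + 0))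
  Complexity-nonZero (_ ∷ _ , _ , _ , refl) = _

  Complexity-unique : ∀ {n m c c′} → Complexity n m c → Complexity n m c′ → c ≡ c′
  Complexity-unique (bs , u , occ , refl) (bs′ , u′ , occ′ , refl) =
    ↭-length (∼bag⇒↭ (unique∧set⇒bag u u′ λ {q} → mk⇔
      (Equivalence.from (occ′ q) ∘ Equivalence.to (occ q))
      (Equivalence.from (occ q) ∘ Equivalence.to (occ′ q))))

private
  Enumeration : Set a → Set a
  Enumeration A = ∃[ xs ] Unique {A = A} xs × (∀ x → x ∈ xs)

  enumerate : ∀ {s} → A ↔ Fin s → Enumeration A
  enumerate {A = A} {s} f =
    List.map from (allFin s) , Unique.map⁺ from-inj (Unique.allFin⁺ s) ,
    λ x → subst (_∈ List.map from (allFin s)) (strictlyInverseʳ x) (∈-map⁺ from (∈-allFin (to x)))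
    where
    open Inverse f
    from-inj : ∀ {i j} → from i ≡ from j → i ≡ j
    from-inj {i} {j} eq =
      trans (sym (strictlyInverseˡ i)) (trans (cong to eq) (strictlyInverseˡ j))

  enumerateVec : Enumeration A → ∀ n → Enumeration (Vec A n)
  enumerateVec e zero = [] ∷ [] , [] ∷ [] , λ { [] → here refl }
  enumerateVec e@(xs , uxs , ∈xs) (suc n) with enumerateVec e n
  ... | vs , uvs , ∈vs =
    cartesianProductWith _∷_ xs vs ,
    Unique.cartesianProductWith⁺ _∷_ ∷-injective uxs uvs ,
    λ { (x ∷ v) → ∈-cartesianProductWith⁺ _∷_ (∈xs x) (∈vs v) }

  ¬¬-filter : (P : A → Set a) → ∀ {xs} → Unique xs →
              ¬ ¬ (∃[ ys ] Unique ys × (∀ x → x ∈ ys ⇔ (x ∈ xs × P x)))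
  ¬¬-filter P {[]} _ k = k ([] , [] , λ x → mk⇔ (λ ()) λ { (() , _) })
  ¬¬-filter P {z ∷ xs} u@(_ ∷ uxs) k = ¬¬-filter P uxs λ { (ys , uys , mem) →
    let absent : ¬ P z → ∀ x → x ∈ ys ⇔ (x ∈ z ∷ xs × P x)
        absent ¬pz x = mk⇔
          (λ x∈ys → let x∈xs , px = Equivalence.to (mem x) x∈ys in there x∈xs , px)
          λ { (here refl , px) → contradiction px ¬pz
            ; (there x∈xs , px) → Equivalence.from (mem x) (x∈xs , px) }
        present : P z → ∀ x → x ∈ z ∷ ys ⇔ (x ∈ z ∷ xs × P x)
        present pz x = mk⇔
          (λ { (here refl) → here refl , pz
             ; (there x∈ys) → let x∈xs , px = Equivalence.to (mem x) x∈ys in there x∈xs , px })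
          λ { (here refl , px) → here refl
            ; (there x∈xs , px) → there (Equivalence.from (mem x) (x∈xs , px)) }
        z∉ys : ∀ {y} → y ∈ ys → z ≢ y
        z∉ys y∈ys z≡y = Unique[x∷xs]⇒x∉xs u
          (subst (_∈ _) (sym z≡y) (proj₁ (Equivalence.to (mem _) y∈ys)))
    in k (ys , uys , absent λ pz →
         k (z ∷ ys , All.tabulate z∉ys ∷ uys , present pz)) }

Complexity-exists : ∀ {s} → A ↔ Fin s → (w : ℤ²-Word A) → ∀ n m → ¬ ¬ ∃ (Complexity w n m)
Complexity-exists fin w n m k with enumerateVec (enumerateVec (enumerate fin) n) m
... | L , uL , ∈L = ¬¬-filter (Occurs w) uL λ { (bs , ubs , mem) →
  k (length bs , bs , ubs , (λ q → mk⇔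
       (proj₂ ∘ Equivalence.to (mem q))
       (λ occ → Equivalence.from (mem q) (∈L q , occ))) , refl) }

-- w has topological entropy h, for an alphabet of cardinality s:
-- log_s c_w(n,n) / n² tends to h.  Since Complexity is single-valued and
-- classically total, quantifying over c just names the value c_w(n,n).
HasEntropy : {A : Set a} (s : ℕ) → .{{NonTrivial s}} → ℤ²-Word A → ℝ → Set a
HasEntropy s w h = ∀ ε → 0ℚᵘ ℚ.< ε → ∃[ N ] (∀ n → .{{_ : NonZero n}} → N ≤ n →
  ∀ c → (cnt : Complexity w n n c) →
  CloserThan ε ((log s c {{c≢0 = Complexity-nonZero w cnt}} ÷ℕ (n ^ 2)) {{ℕ.m^n≢0 n 2}}) h)

{-# OPTIONS --safe #-}

-- Let q be a k × ℓ cover, where ℓ ≤ k after exchanging the axes if necessary.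
-- A horizontal segment of length k is a piece of a row of q followed by a
-- piece of another, so there are at most k (k ℓ)² ≤ k⁵ such segments. Cutting
-- the rows of an n × n block into segments yields, for n ≥ k,
-- c(n,n) ≤ k ^ (5 n (n/k + 1)) ≤ k ^ (10 n²/k), and log k / k tends to 0.

module Submission where

open import Defs
open import Data.Fin as Fin
  using (Fin; toℕ; combine; quotient; remainder; remQuot; finToFun; funToFin; inject≤)
import Data.Fin.Properties as Fin
open import Data.Integer as ℤ using (ℤ; +_; -[1+_]; +<+)
import Data.Integer.Properties as ℤ
import Data.Integer.Tactic.RingSolver as ℤ-Ring
open import Data.List as List using (List; length)
open import Data.List.Membership.Propositional.Properties using (∈-lookup)
open import Data.List.Relation.Unary.All as All using ()
open import Data.List.Relation.Unary.AllPairs using (_∷_)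
open import Data.List.Relation.Unary.Unique.Propositional using (Unique)
open import Data.Nat as ℕ
  using (ℕ; zero; suc; _+_; _*_; _∸_; _^_; _≤_; _<_; z≤n; s≤s; s≤s⁻¹; NonZero; NonTrivial; _≤?_)
import Data.Nat.DivMod as ℕ
open import Data.Nat.DivMod using (_/_; _%_; _mod_)
import Data.Nat.Properties as ℕ
open import Data.Nat.Tactic.RingSolver using (solve-∀)
open import Data.Product using (∃-syntax; Σ-syntax; _×_; _,_; proj₁; proj₂; swap)
open import Data.Product.Function.NonDependent.Propositional using (_×-↔_)
open import Data.Rational.Unnormalised as ℚ using (mkℚᵘ; 0ℚᵘ; *<*)
import Data.Rational.Unnormalised.Properties as ℚ
open import Data.Sum using (_⊎_; inj₁; inj₂)
open import Data.Unit using (tt)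
open import Data.Vec using (lookup)
open import Data.Vec.Relation.Binary.Pointwise.Extensional using (ext; Pointwise-≡⇒≡)
open import Function.Base using (_∘_)
open import Function.Bundles using (_↔_; Equivalence; Inverse)
open import Function.Properties.Inverse using (↔-refl; ↔-trans)
open import Level using (Level)
open import Relation.Binary.PropositionalEquality
open import Relation.Nullary using (¬_; yes; no; contradiction)
open import Relation.Unary using (Pred; Decidable)

private variable
  a : Level
  A : Set a
  k ℓ m n K : ℕ

-- Lists without repetition, bounded search, residues.

Unique⇒lookup-injective : ∀ {xs : List A} → Unique xs →
                          ∀ {i j} → List.lookup xs i ≡ List.lookup xs j → i ≡ j
Unique⇒lookup-injective (_  ∷ _) {Fin.zero}  {Fin.zero}  _  = refl
Unique⇒lookup-injective (x∉ ∷ _) {Fin.zero}  {Fin.suc j} eq =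
  contradiction eq (All.lookup x∉ (∈-lookup j))
Unique⇒lookup-injective (x∉ ∷ _) {Fin.suc i} {Fin.zero}  eq =
  contradiction (sym eq) (All.lookup x∉ (∈-lookup i))
Unique⇒lookup-injective (_  ∷ u) {Fin.suc i} {Fin.suc j} eq =
  cong Fin.suc (Unique⇒lookup-injective u eq)

-- The search runs down from `k` and stops at the first hit, at the latest at 0.
last-satisfying : ∀ {p} {P : Pred ℕ p} → Decidable P → P 0 → ∀ k →
                  ∃[ i ] P i × (i ≡ k ⊎ ¬ P (suc i))
last-satisfying P? p₀ zero    = 0 , p₀ , inj₁ refl
last-satisfying P? p₀ (suc k) with P? (suc k)
... | yes p = suc k , p , inj₁ refl
... | no ¬p with last-satisfying P? p₀ k
...   | i , pᵢ , inj₁ refl = i , pᵢ , inj₂ ¬p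
...   | i , pᵢ , inj₂ ¬p′  = i , pᵢ , inj₂ ¬p′

mod-toℕ : ∀ .{{_ : NonZero k}} {i} (i′ : Fin k) → i ≡ toℕ i′ → i mod k ≡ i′
mod-toℕ i′ refl = Fin.toℕ-injective
  (trans (Fin.toℕ-fromℕ< _) (ℕ.m<n⇒m%n≡m (Fin.toℕ<n i′)))

-- Counting blocks by codes.

-- Blocks are functions here rather than vectors of rows, which makes the
-- definition symmetric under exchange of the axes.
AtMostBlocks : ℤ²-Word A → ℕ → ℕ → ℕ → Set _
AtMostBlocks {A = A} w n m K = Σ[ dec ∈ (Fin K → Fin n → Fin m → A) ]
  (∀ x y → ∃[ c ] ∀ i j → w (x ℤ.+ + toℕ i , y ℤ.+ + toℕ j) ≡ dec c i j)

transposed : (w : ℤ²-Word A) → AtMostBlocks (w ∘ swap) m n K → AtMostBlocks w n m K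
transposed w (dec , codes) = (λ c i j → dec c j i) , λ x y →
  let c , eq = codes y x in c , λ i j → eq j i

restrict : ∀ {n′ m′} → (w : ℤ²-Word A) → n′ ≤ n → m′ ≤ m →
           AtMostBlocks w n m K → AtMostBlocks w n′ m′ K
restrict w n′≤n m′≤m (dec , codes) =
  (λ c i j → dec c (inject≤ i n′≤n) (inject≤ j m′≤m)) , λ x y →
  let c , eq = codes x y in c , λ i j → trans
    (cong₂ (λ i j → w (x ℤ.+ + i , y ℤ.+ + j))
      (sym (Fin.toℕ-inject≤ i n′≤n)) (sym (Fin.toℕ-inject≤ j m′≤m)))
    (eq _ _)

-- The codes of the tiles determine the whole block. They form a function from `Fin (T * U)` to
-- `Fin K`, which `funToFin` packs into one number.
tile : (w : ℤ²-Word A) → ∀ T U →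
       AtMostBlocks w n m K → AtMostBlocks w (T * n) (U * m) (K ^ (T * U))
tile {n = n} {m} {K} w T U (dec , codes) =
  (λ c i j → dec (finToFun c (combine (tᵢ i) (uⱼ j))) (remainder {T} n i) (remainder {U} m j)) ,
  λ x y → funToFin (code x y) , λ i j → trans
    (cong₂ (λ x y → w (x , y)) (split T n x i) (split U m y j))
    (trans (proj₂ (codes _ _) _ _) (cong (λ c → dec c _ _) (sym (code-combine x y (tᵢ i) (uⱼ j)))))
  where
  tᵢ = quotient {T} n
  uⱼ = quotient {U} m

  corner : ∀ {T} → ℤ → ℕ → Fin T → ℤ
  corner x n t = x ℤ.+ + (n * toℕ t)

  tileCode : ℤ → ℤ → Fin T × Fin U → Fin K
  tileCode x y (t , u) = proj₁ (codes (corner x n t) (corner y m u))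

  code : ℤ → ℤ → Fin (T * U) → Fin K
  code x y = tileCode x y ∘ remQuot U

  code-combine : ∀ x y t u → finToFun (funToFin (code x y)) (combine t u) ≡ tileCode x y (t , u)
  code-combine x y t u = trans (Fin.finToFun-funToFin (code x y) (combine t u))
    (cong (tileCode x y) (Fin.remQuot-combine t u))

  split : ∀ T n x (i : Fin (T * n)) →
          x ℤ.+ + toℕ i ≡ corner x n (quotient {T} n i) ℤ.+ + toℕ (remainder {T} n i)
  split T n x i = trans
    (cong (λ z → x ℤ.+ + z)
      (trans (cong toℕ (sym (Fin.combine-remQuot {T} n i))) (Fin.toℕ-combine {T} {n} _ _)))
    (sym (ℤ.+-assoc x _ _))

-- Sending each listed block to the code of one of its occurrences is injective, because the code
-- decodes to the block.
complexity-bound : ∀ {c} → (w : ℤ²-Word A) → AtMostBlocks w n m K → Complexity w n m c → c ≤ K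
complexity-bound w (dec , codes) (bs , uniq , occ , refl) =
  Fin.injective⇒≤ {f = code} λ {i} {j} eq → Unique⇒lookup-injective uniq
    (Pointwise-≡⇒≡ (ext λ r → Pointwise-≡⇒≡ (ext λ s →
      trans (decodes i r s) (trans (cong (λ c → dec c s r) eq) (sym (decodes j r s))))))
  where
  occurs : ∀ i → Occurs w (List.lookup bs i)
  occurs i = Equivalence.to (occ _) (∈-lookup i)

  code : Fin (length bs) → Fin _
  code i = let (x , y) , _ = occurs i in proj₁ (codes x y)

  decodes : ∀ i r s → lookup (lookup (List.lookup bs i) r) s ≡ dec (code i) s r
  decodes i r s = let (x , y) , at = occurs i in
    trans (sym (at s r)) (proj₂ (codes x y) s r)

-- Covers and horizontal segments.

-- An occurrence is recorded by the place `(i₀ , j₀)` of `(x , y)` inside it, not by its corner: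
-- this leaves finitely many choices, so that they can serve as codes.
CoveredBy : ℤ²-Word A → (Fin k → Fin ℓ → A) → Set _
CoveredBy {k = k} {ℓ = ℓ} w q = ∀ x y → Σ[ i₀ ∈ Fin k ] Σ[ j₀ ∈ Fin ℓ ] (∀ i j →
  w (x ℤ.- + toℕ i₀ ℤ.+ + toℕ i , y ℤ.- + toℕ j₀ ℤ.+ + toℕ j) ≡ q i j)

coveredBy-swap : ∀ {q : Fin k → Fin ℓ → A} → (w : ℤ²-Word A) → CoveredBy w q →
                 CoveredBy (w ∘ swap) λ j i → q i j
coveredBy-swap w cov x y = let i₀ , j₀ , eq = cov y x in j₀ , i₀ , λ j i → eq i j

cover⇒coveredBy : ∀ (w : ℤ²-Word A) (q : Block A k ℓ) → IsCover w q →
                  CoveredBy w λ i j → lookup (lookup q j) i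
cover⇒coveredBy w q cover x y with cover (x , y)
... | (vx , vy) , at , i₀ , j₀ , refl = i₀ , j₀ , λ i j →
  trans (cong₂ (λ x y → w (x ℤ.+ + toℕ i , y ℤ.+ + toℕ j)) (cancel vx _) (cancel vy _)) (at i j)
  where
  cancel : ∀ u v → u ℤ.+ v ℤ.- v ≡ u
  cancel = ℤ-Ring.solve-∀

-- An occurrence of q meeting a horizontal segment of length k covers a prefix
-- or a suffix of it. Fix an occurrence covering each position. If p is the last
-- position for which it covers a prefix, then the two occurrences fixed for p
-- and p + 1 determine the segment.
segments : ∀ .{{_ : NonZero k}} (w : ℤ²-Word A) {q : Fin k → Fin ℓ → A} → CoveredBy w q →
           AtMostBlocks w k 1 (k * ((k * ℓ) * (k * ℓ)))
segments {k = k@(suc k-1)} {A = A} {ℓ = ℓ} w {q = q} cov = (λ c i _ → decode (to c) (toℕ i)) ,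
  λ x y → from (code x y) , λ { i Fin.zero → correct x y i }
  where
  Occurrence Code : Set
  Occurrence = Fin k × Fin ℓ
  Code = Fin k × (Occurrence × Occurrence)

  codes↔ : Fin (k * ((k * ℓ) * (k * ℓ))) ↔ Code
  codes↔ = ↔-trans Fin.*↔× (↔-refl ×-↔ ↔-trans Fin.*↔× (Fin.*↔× ×-↔ Fin.*↔×))

  open Inverse codes↔ using (to; from; strictlyInverseˡ)

  -- An occurrence is given by the column and the row of q at position t of the
  -- segment.
  read : ℕ → Occurrence → ℕ → A
  read t (i₀ , j₀) i = q ((i + toℕ i₀ ∸ t) mod k) j₀

  paste : ℕ → Occurrence × Occurrence → ℕ → A
  paste p (o₁ , o₂) i with i ≤? p
  ... | yes _ = read p o₁ i
  ... | no  _ = read (suc p) o₂ i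

  decode : Code → ℕ → A
  decode (p , os) = paste (toℕ p) os

  module _ (x y : ℤ) where
    col : ℕ → Fin k
    col t = proj₁ (cov (x ℤ.+ + t) y)

    row : ℕ → Fin ℓ
    row t = proj₁ (proj₂ (cov (x ℤ.+ + t) y))

    occurrence : ℕ → Occurrence
    occurrence t = col t , row t

    -- The two inequalities say that position `i` lies within the columns of the occurrence, where
    -- neither `∸` nor `mod` in `read` distorts the index.
    read-correct : ∀ t i → t ≤ i + toℕ (col t) → i + toℕ (col t) < t + k →
                   w (x ℤ.+ + i , y ℤ.+ + 0) ≡ read t (occurrence t) i
    read-correct t i t≤ <t+k = trans
      (cong₂ (λ x y → w (x , y)) eq-x (eq-y y _))
      (trans (proj₂ (proj₂ (cov (x ℤ.+ + t) y)) i′ (row t))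
        (cong (λ i → q i (row t)) (sym (mod-toℕ i′ (sym i′≡)))))
      where
      c = toℕ (col t)

      i′ : Fin k
      i′ = Fin.fromℕ< (ℕ.m<n+o⇒m∸n<o (i + c) t <t+k)

      i′≡ : toℕ i′ ≡ i + c ∸ t
      i′≡ = Fin.toℕ-fromℕ< _

      shift : ∀ x i t c i′ → i ℤ.+ c ≡ t ℤ.+ i′ → x ℤ.+ i ≡ x ℤ.+ t ℤ.- c ℤ.+ i′
      shift x i t c i′ eq = trans (l x i c) (trans (cong (λ z → x ℤ.+ z ℤ.- c) eq) (r x t i′ c))
        where
        l : ∀ x i c → x ℤ.+ i ≡ x ℤ.+ (i ℤ.+ c) ℤ.- c
        l = ℤ-Ring.solve-∀
        r : ∀ x t i′ c → x ℤ.+ (t ℤ.+ i′) ℤ.- c ≡ x ℤ.+ t ℤ.- c ℤ.+ i′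
        r = ℤ-Ring.solve-∀

      eq-x : x ℤ.+ + i ≡ x ℤ.+ + t ℤ.- + c ℤ.+ + toℕ i′
      eq-x = shift x (+ i) (+ t) (+ c) (+ toℕ i′)
        (cong +_ (trans (sym (ℕ.m+[n∸m]≡n t≤)) (cong (t ℕ.+_) (sym i′≡))))

      eq-y : ∀ y c → y ℤ.+ + 0 ≡ y ℤ.- c ℤ.+ c
      eq-y = ℤ-Ring.solve-∀

    -- The occurrence at `t` starts at `t - col t`, so `t ≤ col t` says that it reaches back to the
    -- start of the segment.
    cut : ∃[ p ] p ≤ toℕ (col p) × (p ≡ k-1 ⊎ ¬ suc p ≤ toℕ (col (suc p)))
    cut = last-satisfying (λ p → p ≤? toℕ (col p)) z≤n k-1

    p : ℕ
    p = proj₁ cut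

    p≤col : p ≤ toℕ (col p)
    p≤col = proj₁ (proj₂ cut)

    p′ : Fin k
    p′ = Fin.fromℕ< (ℕ.≤-<-trans p≤col (Fin.toℕ<n (col p)))

    occurrences : Occurrence × Occurrence
    occurrences = occurrence p , occurrence (suc p)

    code : Code
    code = p′ , occurrences

    paste-correct : ∀ (i : Fin k) → w (x ℤ.+ + toℕ i , y ℤ.+ + 0) ≡
                    paste p occurrences (toℕ i)
    paste-correct i with toℕ i ≤? p
    ... | yes i≤p = read-correct p (toℕ i) (ℕ.m≤n⇒m≤o+n (toℕ i) p≤col)
                      (ℕ.+-mono-≤-< i≤p (Fin.toℕ<n (col p)))
    ... | no  i≰p with proj₂ (proj₂ cut)
    -- The first occurrence covers the whole segment; no `i` lies beyond `p`.
    ...   | inj₁ p≡k-1 = contradiction (subst (toℕ i ≤_) (sym p≡k-1) (s≤s⁻¹ (Fin.toℕ<n i))) i≰p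
    -- The occurrence at `suc p` starts after position 0, so its `k` columns run past the end of the
    -- segment.
    ...   | inj₂ col≰  = read-correct (suc p) (toℕ i) (ℕ.m≤n⇒m≤n+o _ (ℕ.≰⇒> i≰p))
                           (subst (_< suc p + k) (ℕ.+-comm (toℕ (col (suc p))) (toℕ i))
                             (ℕ.+-mono-< (ℕ.≰⇒> col≰) (Fin.toℕ<n i)))

    correct : ∀ (i : Fin k) → w (x ℤ.+ + toℕ i , y ℤ.+ + 0) ≡ decode (to (from code)) (toℕ i)
    correct i = trans (paste-correct i) (trans
      (cong (λ p → paste p occurrences (toℕ i)) (sym (Fin.toℕ-fromℕ< _)))
      (cong (λ c → decode c (toℕ i)) (sym (strictlyInverseˡ code))))

-- Powers against exponentials.

n<2^n : ∀ n → n < 2 ^ n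
n<2^n zero    = s≤s z≤n
n<2^n (suc n) = ℕ.≤-<-trans (n<2^n n) (ℕ.^-monoʳ-< 2 (s≤s (s≤s z≤n)) (ℕ.n<1+n n))

m<suc[m/n]*n : ∀ m n .{{_ : NonZero n}} → m < suc (m / n) * n
m<suc[m/n]*n m n = begin-strict
  m                    ≡⟨ ℕ.m≡m%n+[m/n]*n m n ⟩
  m % n + m / n * n    <⟨ ℕ.+-monoˡ-< (m / n * n) (ℕ.m%n<n m n) ⟩
  n + m / n * n        ∎
  where open ℕ.≤-Reasoning

-- For `m = k / d` one has `k < suc m * d`, and both factors are at most `2 ^ m`; the threshold
-- `d * d` ensures `d ≤ m`. Raising to the power `E` gives `2 ^ (m * d)`, since `d = 2 * E`.
power<exponential : ∀ E .{{_ : NonZero E}} → ∃[ K ] ∀ k → K ≤ k → k ^ E < 2 ^ k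
power<exponential E@(suc _) = d * d , λ k d*d≤k →
  let m = k / d
      d≤m : d ≤ m
      d≤m = subst (_≤ m) (ℕ.m*n/n≡m d d) (ℕ./-monoˡ-≤ d d*d≤k)
  in begin-strict
    k ^ E                  <⟨ ℕ.^-monoˡ-< E (m<suc[m/n]*n k d) ⟩
    (suc m * d) ^ E        ≤⟨ ℕ.^-monoˡ-≤ E (ℕ.*-mono-≤ (n<2^n m)
                                (ℕ.≤-trans d≤m (ℕ.<⇒≤ (n<2^n m)))) ⟩
    (2 ^ m * 2 ^ m) ^ E    ≡⟨ cong (_^ E) (ℕ.^-distribˡ-+-* 2 m m) ⟨
    (2 ^ (m + m)) ^ E      ≡⟨ ℕ.^-*-assoc 2 (m + m) E ⟩
    2 ^ ((m + m) * E)      ≡⟨ cong (2 ^_) (double m E) ⟩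
    2 ^ (m * d)            ≤⟨ ℕ.^-monoʳ-≤ 2 (ℕ.m/n*n≤m k d) ⟩
    2 ^ k                  ∎
  where
  open ℕ.≤-Reasoning
  d : ℕ
  d = 2 * E
  double : ∀ m E → (m + m) * E ≡ m * (2 * E)
  double = solve-∀

-- Bounds on the number of square blocks.

-- Each of the `n` rows is overshot by `suc (n / k)` segments, and the excess is cut off.
blocks-bound : ∀ .{{_ : NonZero k}} (w : ℤ²-Word A) {q : Fin k → Fin ℓ → A} → ℓ ≤ k → CoveredBy w q → ∀ n →
               ∃[ K ] K ≤ (k ^ 5) ^ (suc (n / k) * n) × AtMostBlocks w n n K
blocks-bound {k = k} {ℓ = ℓ} w ℓ≤k cov n = _ , ℕ.^-monoˡ-≤ (T * n) codes≤ ,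
  restrict w (ℕ.<⇒≤ (m<suc[m/n]*n n k)) (ℕ.≤-reflexive (sym (ℕ.*-identityʳ n)))
    (tile w T n (segments w cov))
  where
  T = suc (n / k)
  open ℕ.≤-Reasoning
  k^5 : ∀ k → k * ((k * k) * (k * k)) ≡ k * (k * (k * (k * (k * 1))))
  k^5 = solve-∀
  codes≤ : k * ((k * ℓ) * (k * ℓ)) ≤ k ^ 5
  codes≤ = begin
    k * ((k * ℓ) * (k * ℓ))    ≤⟨ ℕ.*-monoʳ-≤ k (ℕ.*-mono-≤ (ℕ.*-monoʳ-≤ k ℓ≤k)
                                    (ℕ.*-monoʳ-≤ k ℓ≤k)) ⟩
    k * ((k * k) * (k * k))    ≡⟨ k^5 k ⟩
    k ^ 5                      ∎

-- Comparing `k`-th powers avoids the fractional exponent `1 / k`.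
bound-subexponential : ∀ {c} D → .{{_ : NonZero k}} .{{_ : NonZero n}} → k ≤ n →
                       k ^ (10 * D) < 2 ^ k → c ≤ (k ^ 5) ^ (suc (n / k) * n) →
                       c ^ D < 2 ^ (n ^ 2)
bound-subexponential {k} {n@(suc _)} {c} D k≤n small c≤ = ℕ.≰⇒> λ 2^n²≤c^D → ℕ.<-irrefl refl (begin-strict
  (2 ^ (n ^ 2)) ^ k               ≤⟨ ℕ.^-monoˡ-≤ k 2^n²≤c^D ⟩
  (c ^ D) ^ k                     ≤⟨ ℕ.^-monoˡ-≤ k (ℕ.^-monoˡ-≤ D c≤) ⟩
  (((k ^ 5) ^ (T * n)) ^ D) ^ k   ≡⟨ collect ⟩
  k ^ (5 * (T * n) * D * k)       ≤⟨ ℕ.^-monoʳ-≤ k exponent≤ ⟩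
  k ^ (10 * D * n ^ 2)            ≡⟨ ℕ.^-*-assoc k (10 * D) (n ^ 2) ⟨
  (k ^ (10 * D)) ^ (n ^ 2)        <⟨ ℕ.^-monoˡ-< (n ^ 2) small ⟩
  (2 ^ k) ^ (n ^ 2)               ≡⟨ ℕ.^-*-assoc 2 k (n ^ 2) ⟩
  2 ^ (k * n ^ 2)                 ≡⟨ cong (2 ^_) (ℕ.*-comm k (n ^ 2)) ⟩
  2 ^ (n ^ 2 * k)                 ≡⟨ ℕ.^-*-assoc 2 (n ^ 2) k ⟨
  (2 ^ (n ^ 2)) ^ k               ∎)
  where
  open ℕ.≤-Reasoning
  T : ℕ
  T = suc (n / k)
  collect : (((k ^ 5) ^ (T * n)) ^ D) ^ k ≡ k ^ (5 * (T * n) * D * k)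
  collect = trans (cong (λ z → (z ^ D) ^ k) (ℕ.^-*-assoc k 5 (T * n)))
    (trans (cong (_^ k) (ℕ.^-*-assoc k (5 * (T * n)) D)) (ℕ.^-*-assoc k (5 * (T * n) * D) k))
  group : ∀ T n D k → 5 * (T * n) * D * k ≡ 5 * D * n * (T * k)
  group = solve-∀
  ungroup : ∀ n D → 5 * D * n * (n + n) ≡ 10 * D * (n * (n * 1))
  ungroup = solve-∀
  exponent≤ : 5 * (T * n) * D * k ≤ 10 * D * n ^ 2
  exponent≤ = begin
    5 * (T * n) * D * k        ≡⟨ group T n D k ⟩
    -- `T * k` is `k + n / k * k`, at most `2 * n`; this doubles 5 to 10.
    5 * D * n * (T * k)        ≤⟨ ℕ.*-monoʳ-≤ (5 * D * n) (ℕ.+-mono-≤ k≤n (ℕ.m/n*n≤m n k)) ⟩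
    5 * D * n * (n + n)        ≡⟨ ungroup n D ⟩
    10 * D * n ^ 2             ∎

blocks-subexponential : ∀ .{{_ : NonZero k}} (w : ℤ²-Word A) {q : Fin k → Fin ℓ → A} D →
  ℓ ≤ k → CoveredBy w q → k ^ (10 * D) < 2 ^ k →
  ∀ n → .{{_ : NonZero n}} → k ≤ n → ∃[ K ] K ^ D < 2 ^ (n ^ 2) × AtMostBlocks w n n K
blocks-subexponential w D ℓ≤k cov small n k≤n =
  let K , K≤ , blocks = blocks-bound w ℓ≤k cov n
  in K , bound-subexponential D k≤n small K≤ , blocks

-- This is `log₂ c / n² < 1 / D` without logarithms or fractions. The cover depends on `D` alone and
-- stays fixed as `n` grows.
complexity-subexponential : (w : ℤ²-Word A) → MultiScaleCoverable w → ∀ D .{{_ : NonZero D}} →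
  ∃[ N ] ∀ n → .{{_ : NonZero n}} → N ≤ n → ∀ {c} → Complexity w n n c → c ^ D < 2 ^ (n ^ 2)
complexity-subexponential w multi D@(suc _)
  with K , small ← power<exponential (10 * D)
  -- The successor makes both sides of the cover nonzero. Both exceed `K`, so whichever is longer
  -- can be the segment length.
  with multi (suc K)
... | k@(suc _) , ℓ@(suc _) , K<k , K<ℓ , q , cover with ℕ.≤-total ℓ k
...   | inj₁ ℓ≤k = k , λ n k≤n cnt →
  let _ , bound , blocks = blocks-subexponential w D ℓ≤k
        (cover⇒coveredBy w q cover) (small k (ℕ.<⇒≤ K<k)) n k≤n
  in ℕ.≤-<-trans (ℕ.^-monoˡ-≤ D (complexity-bound w blocks cnt)) bound
...   | inj₂ k≤ℓ = ℓ , λ n ℓ≤n cnt →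
  let _ , bound , blocks = blocks-subexponential (w ∘ swap) D k≤ℓ
        (coveredBy-swap w (cover⇒coveredBy w q cover)) (small ℓ (ℕ.<⇒≤ K<ℓ)) n ℓ≤n
  in ℕ.≤-<-trans (ℕ.^-monoˡ-≤ D (complexity-bound w (transposed w blocks) cnt)) bound

-- From counting to zero entropy.

closeTo0 : ∀ {ε q} x → q ℚ.< ε → lower x (ℚ.- q) → upper x q → CloserThan ε x 0ℝ
closeTo0 {ε} {q} x q<ε l u =
  (ℚ.- q , ℚ.<-respˡ-≃ (ℚ.+-inverseˡ q)
     (ℚ.+-monoʳ-< (ℚ.- q) (ℚ.<-respʳ-≃ (ℚ.≃-sym (ℚ.neg-involutive ε)) q<ε)) , l) ,
  (q , u , ℚ.<-respʳ-≃ (ℚ.+-inverseʳ ε) (ℚ.+-monoˡ-< (ℚ.- ε) q<ε))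

-- The upper cut at `1 / (d + 1)`, rescaled by `m`, is the condition `c ^ suc d < b ^ m`. The lower
-- one is `tt`, since its rational is negative.
log÷-closeTo0 : ∀ {ε b c} d m .{{_ : NonTrivial b}} .{{c≢0 : NonZero c}} .{{_ : NonZero m}} →
                mkℚᵘ (+ 1) d ℚ.< ε → c ^ suc d < b ^ m → CloserThan ε (log b c ÷ℕ m) 0ℝ
log÷-closeTo0 {b = b} {c} d m@(suc m-1) 1/d<ε c^d<b^m = closeTo0 (log b c ÷ℕ m) 1/d<ε tt
  (subst₂ (λ u v → c ^ suc u < b ^ suc v)
    (sym (ℕ.*-identityʳ d)) (sym (ℕ.+-identityʳ m-1)) c^d<b^m)

archimedean : ∀ {ε} → 0ℚᵘ ℚ.< ε → ∃[ d ] mkℚᵘ (+ 1) d ℚ.< ε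
-- `mkℚᵘ` stores the denominator minus one, so the witness is `1 / (d + 2)`, strictly below
-- `1 / (d + 1)`.
archimedean {mkℚᵘ (+ suc p) d} _ = suc d , *<* (+<+ (ℕ.<-≤-trans 1d<d+2 (ℕ.m≤m+n _ _)))
  where
  1d<d+2 : 1 * suc d < suc (suc d)
  1d<d+2 = s≤s (s≤s (ℕ.≤-reflexive (ℕ.+-identityʳ d)))
archimedean {mkℚᵘ (+ zero) d} (*<* (+<+ ()))
archimedean {mkℚᵘ -[1+ _ ] d} (*<* ())

proposition11 : ∀ {a} {A : Set a} {s : ℕ} .{{_ : NonTrivial s}} → A ↔ Fin s →
    (w : ℤ²-Word A) → MultiScaleCoverable w → HasEntropy s w 0ℝ
proposition11 {s = s} _ w multi ε 0<ε =
  let d , 1/d<ε = archimedean 0<ε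
      N , bound = complexity-subexponential w multi (suc d)
  in N , λ n N≤n c cnt →
    log÷-closeTo0 d (n ^ 2) {{c≢0 = Complexity-nonZero w cnt}} {{ℕ.m^n≢0 n 2}} 1/d<ε
      -- Base 2 is the worst case, as `s ≥ 2`.
      (ℕ.<-≤-trans (bound n N≤n cnt) (ℕ.^-monoˡ-≤ (n ^ 2) (ℕ.nonTrivial⇒n>1 s)))
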